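{- Let $\mathcal I,\mathcal J$ be ideals on $\omega$ and let $\mathcal F\subseteq\omega^\omega$. If $\mathfrak{fip}(\mathcal I,\mathcal J,\mathcal F)\ge|\mathcal F|$, then there exists an ultrafilter $\mathcal U$ on $\omega$ such that $\mathcal I\not\le_{\mathcal F}\mathcal U^*$ and $\mathcal J\subseteq\mathcal U^*$. In particular, if (under this assumption) $\mathcal F=\omega^\omega$ ($\mathcal F$ is the family of all finite-to-one functions, or $\mathcal F$ is the family of all one-to-one functions $\omega\to\omega$, respectively), then there exists an $\mathcal I$-ultrafilter (a weak $\mathcal I$-ultrafilter, or an $\mathcal I$-point, respectively) which is not a $\mathcal J$-point.
   Context: An ideal on $\omega$ is a family of subsets of $\omega$ closed under finite unions and subsets, containing all finite sets and not containing $\omega$; $\mathcal J^+=\mathcal P(\omega)\setminus\mathcal J$. Ultrafilters on $\omega$ contain all cofinite sets; $\mathcal U^*=\{\omega\setminus A:A\in\mathcal U\}$ is the dual ideal. For $\mathcal F\subseteq\omega^\omega$ and ideals $\mathcal I,\mathcal K$ on $\omega$, $\mathcal I\le_{\mathcal F}\mathcal K$ means that there is $f\in\mathcal F$ with $f^{ -1}[B]\in\mathcal K$ for every $B\in\mathcal I$. A nonempty family $\mathcal A\subseteq\mathcal P(\omega)$ has $\mathcal J^+$-FIP if $\bigcap F\in\mathcal J^+$ for each finite $F\subseteq\mathcal A$. With $\mathfrak c=2^{\aleph_0}$ and $\mathfrak c^+$ its successor cardinal, $\mathfrak{fip}(\mathcal I,\mathcal J,\mathcal F)$ is the minimum of the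 set consisting of $\mathfrak c^+$ and all cardinals $|\mathcal A|$ such that $\mathcal A$ has $\mathcal J^+$-FIP (so $\mathcal A$ is a nonempty family of subsets of $\omega$) and it is not true that for every $f\in\mathcal F$ there is $B\in\mathcal I$ such that $\mathcal A\cup\{f^{ -1}[B]\}$ has $\mathcal J^+$-FIP. An ultrafilter $\mathcal U$ on $\omega$ is an $\mathcal I$-ultrafilter (weak $\mathcal I$-ultrafilter, $\mathcal I$-point, respectively) if $\mathcal I\not\le_{\mathcal F}\mathcal U^*$ where $\mathcal F$ is the family of all (all finite-to-one, all one-to-one, respectively) functions $\omega\to\omega$; a $\mathcal J$-point is defined in the same way with $\mathcal J$ in place of $\mathcal I$. A function is finite-to-one if preimages of points are finite.
   Formalization: The first conclusion is proved under the added condition that if F has exactly one element then I ≤_F J fails; without it the claim is false (I = J = Fin, F = {id}, where fip = 1), and whenever the condition fails the conclusion fails too. -}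

-- The ambient theory is ZFC.  It is rendered by two hypotheses of the theorem:
-- excluded middle and function extensionality, both at level zero.
-- ExcludedMiddle 0ℓ decides every type, not only propositions, so it
-- returns a witness of each inhabited type; together with function
-- extensionality it yields the axiom of choice.  No further choice principle
-- is therefore assumed.

module Defs where

open import Level using (0ℓ; suc)
open import Data.Bool using (Bool; true; _∧_; _∨_; not; T)
open import Data.List using (List; foldr)
open import Data.List.Membership.Propositional using () renaming (_∈_ to _∈ˡ_)
open import Data.List.Relation.Unary.All using (All)
open import Data.Nat using (ℕ)
open import Data.Product using (∃; ∃-syntax; _×_; proj₁)
open import Data.Sum using (_⊎_)
open import Function using (_∘_; Injective)
open import Function.Bundles using (Injection; Bijection)
open import Relation.Binary.Bundles using (Setoid)
open import Relation.Binary.PropositionalEquality using (_≡_; setoid)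
import Relation.Binary.Construct.On as On
open import Relation.Nullary using (¬_)
open import Relation.Unary using (Pred; _∈_; _∉_; _⊆_; _≐_; _∪_; ｛_｝; Satisfiable; U)

infix  4 _⊆ˢ_ _≤ᶜ_ _<ᶜ_ _≈ᶜ_ _≤[_]_
infixr 6 _∪ˢ_
infixr 7 _∩ˢ_
infix  8 _*
infix  9 _⁻¹[_]

-- A subset of ω is its characteristic function.  By excluded middle every
-- predicate on ω has one, and by function extensionality _≡_ is equality of
-- sets.

Subset : Set
Subset = ℕ → Bool

⟦_⟧ : Subset → Pred ℕ 0ℓ
⟦ A ⟧ n = T (A n)

_⊆ˢ_ : Subset → Subset → Set
A ⊆ˢ B = ⟦ A ⟧ ⊆ ⟦ B ⟧

ω : Subset
ω _ = true

∁ˢ : Subset → Subset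
∁ˢ A = not ∘ A

_∪ˢ_ _∩ˢ_ : Subset → Subset → Subset
(A ∪ˢ B) n = A n ∨ B n
(A ∩ˢ B) n = A n ∧ B n

⋂ : List Subset → Subset
⋂ = foldr _∩ˢ_ ω

_⁻¹[_] : (ℕ → ℕ) → Subset → Subset
f ⁻¹[ B ] = B ∘ f

Finite : ∀ {A : Set} → Pred A 0ℓ → Set
Finite P = ∃[ xs ] P ⊆ (_∈ˡ xs)

Family : Set₁
Family = Pred Subset 0ℓ

-- Closure under unions of two sets suffices: the union of the empty
-- subfamily is ∅, which is finite.

record IsIdeal (𝓘 : Family) : Set where
  field
    ∪-closed : ∀ {A B} → A ∈ 𝓘 → B ∈ 𝓘 → A ∪ˢ B ∈ 𝓘
    ⊆-closed : ∀ {A B} → A ⊆ˢ B → B ∈ 𝓘 → A ∈ 𝓘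
    finite   : ∀ {A} → Finite ⟦ A ⟧ → A ∈ 𝓘
    proper   : ω ∉ 𝓘

record IsUltrafilter (𝓤 : Family) : Set where
  field
    ∩-closed : ∀ {A B} → A ∈ 𝓤 → B ∈ 𝓤 → A ∩ˢ B ∈ 𝓤
    ⊆-closed : ∀ {A B} → A ⊆ˢ B → A ∈ 𝓤 → B ∈ 𝓤
    proper   : ∁ˢ ω ∉ 𝓤
    ultra    : ∀ A → A ∈ 𝓤 ⊎ ∁ˢ A ∈ 𝓤
    cofinite : ∀ {A} → Finite ⟦ ∁ˢ A ⟧ → A ∈ 𝓤

_⁺ : Family → Family
(𝓙 ⁺) A = A ∉ 𝓙

_* : Family → Family
(𝓤 *) B = ∃[ A ] A ∈ 𝓤 × B ≡ ∁ˢ A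

_≤[_]_ : Family → Pred (ℕ → ℕ) 0ℓ → Family → Set
𝓘 ≤[ 𝓕 ] 𝓚 = ∃[ f ] f ∈ 𝓕 × (∀ {B} → B ∈ 𝓘 → f ⁻¹[ B ] ∈ 𝓚)

AllFunctions FiniteToOne OneToOne : Pred (ℕ → ℕ) 0ℓ
AllFunctions   = U
FiniteToOne  f = ∀ n → Finite (λ m → f m ≡ n)
OneToOne     f = Injective _≡_ _≡_ f

Ultrafilter-for WeakUltrafilter-for Point-for : Family → Family → Set
Ultrafilter-for     𝓘 𝓤 = IsUltrafilter 𝓤 × ¬ (𝓘 ≤[ AllFunctions ] 𝓤 *)
WeakUltrafilter-for 𝓘 𝓤 = IsUltrafilter 𝓤 × ¬ (𝓘 ≤[ FiniteToOne ] 𝓤 *)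
Point-for           𝓘 𝓤 = IsUltrafilter 𝓤 × ¬ (𝓘 ≤[ OneToOne ] 𝓤 *)

-- A finite subfamily is listed, possibly with repetitions; the intersection
-- of the empty one is ω.

HasFIP : Family → Family → Set
HasFIP 𝓙 𝓐 = Satisfiable 𝓐 × (∀ {Xs} → All (_∈ 𝓐) Xs → ⋂ Xs ∈ 𝓙 ⁺)

-- Cardinals are sets up to bijection, a set being a setoid.

Cardinal : Set₁
Cardinal = Setoid 0ℓ 0ℓ

_≤ᶜ_ _<ᶜ_ _≈ᶜ_ : Cardinal → Cardinal → Set
κ ≤ᶜ μ = Injection κ μ
κ <ᶜ μ = κ ≤ᶜ μ × ¬ (μ ≤ᶜ κ)
κ ≈ᶜ μ = Bijection κ μ

-- Equality of members ignores the proofs of membership: a predicate need not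
-- be proof-irrelevant, and each element must be counted once.

∣_∣ : ∀ {A : Set} → Pred A 0ℓ → Cardinal
∣_∣ {A} P = On.setoid {B = ∃ P} (setoid A) proj₁

𝔠 : Cardinal
𝔠 = setoid (ℕ → Bool)

IsSuccessorOf : Cardinal → Cardinal → Set₁
IsSuccessorOf κ μ = κ <ᶜ μ × (∀ ν → κ <ᶜ ν → μ ≤ᶜ ν)

IsMinimumOf : Pred Cardinal (suc 0ℓ) → Cardinal → Set₁
IsMinimumOf S κ = κ ∈ S × (∀ μ → μ ∈ S → κ ≤ᶜ μ)

NotExtendable : Family → Family → Pred (ℕ → ℕ) 0ℓ → Family → Set
NotExtendable 𝓘 𝓙 𝓕 𝓐 =
  ¬ (∀ {f} → f ∈ 𝓕 → ∃[ B ] B ∈ 𝓘 × HasFIP 𝓙 (𝓐 ∪ ｛ f ⁻¹[ B ] ｝))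

-- κ is the cardinal fip(𝓘,𝓙,𝓕): the minimum of the set consisting of 𝔠⁺ and
-- the cardinalities below.  Membership in that set is up to bijection, so κ is
-- determined up to bijection.

IsFip : Family → Family → Pred (ℕ → ℕ) 0ℓ → Cardinal → Set₁
IsFip 𝓘 𝓙 𝓕 = IsMinimumOf λ μ →
  IsSuccessorOf 𝔠 μ ⊎
  (∃[ 𝓐 ] HasFIP 𝓙 𝓐 × NotExtendable 𝓘 𝓙 𝓕 𝓐 × μ ≈ᶜ ∣ 𝓐 ∣)

IsSingleton : ∀ {A : Set} → Pred A 0ℓ → Set
IsSingleton P = ∃[ x ] P ≐ ｛ x ｝

{-# OPTIONS --safe #-}
module Submission where

-- Well-order 𝓕 so that it does not embed into any of its proper initial
-- segments (`initial-order`), and choose B_f ∈ 𝓘 for f ∈ 𝓕 by transfinite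
-- recursion so that the sets f⁻¹[B_f] together have 𝓙⁺-FIP (`transfinite`).
-- At stage f the family 𝓐 of the sets already chosen has 𝓙⁺-FIP, since a
-- finite subfamily consists of sets chosen up to some earlier stage.  It is
-- indexed by a proper initial segment, so ∣ 𝓕 ∣ does not embed into ∣ 𝓐 ∣.  If
-- 𝓐 could not be extended at f, then ∣ 𝓕 ∣ ≤ fip ≤ ∣ 𝓐 ∣, a contradiction
-- (`extendable`).  The first stage is special: there 𝓐 is empty, hence is not
-- one of the families that fip speaks of, and {ω} must take its place.  The set
-- {ω} is too small to be non-extendable unless 𝓕 has only one element, and for
-- a singleton the side condition, that 𝓘 ≰ 𝓙 along 𝓕, supplies the set B_f
-- directly (`extend-∅`).
--
-- The sets Y such that ⋂ Ys ∩ Y ∈ 𝓙, for a finite list Ys of the chosen sets,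
-- form an ideal (`generated-isIdeal`).  An ultrafilter 𝓤 disjoint from it
-- (`ideal-avoiding-ultrafilter`, a second use of `transfinite`, now along a
-- well-order of the sets to be decided) contains every f⁻¹[B_f] and the
-- complement of every member of 𝓙, so 𝓘 ≰ 𝓤* along 𝓕 and 𝓙 ⊆ 𝓤*.
-- The last inclusion says that the identity function witnesses 𝓙 ≤ 𝓤*, so 𝓤 is
-- not a 𝓙-point.  The three particular families 𝓕 contain both the identity and
-- the successor function, so the side condition holds for them vacuously.
--
-- Well-orders come from Zermelo's theorem.  It is proved for an arbitrary set,
-- by iterating transfinitely the operation that adds a chosen new element to a
-- part of the set; the stages of the iteration are linearly ordered by
-- inclusion.

open import Defs
open import Level using (0ℓ)
open import Axiom.ExcludedMiddle using (ExcludedMiddle)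
open import Axiom.Extensionality.Propositional
  using (Extensionality; implicit-extensionality)
open import Data.Bool using (Bool; true; false; not; T)
open import Data.Bool.Properties using (T-∧; T-∨; T-irrelevant; not-involutive)
open import Data.Empty using (⊥-elim)
open import Data.List using ([]; _∷_; _++_)
open import Data.List.Relation.Unary.All as All using (All; []; _∷_)
open import Data.List.Relation.Unary.All.Properties using (++⁺; ++⁻ˡ; ++⁻ʳ)
open import Data.List.Relation.Unary.Any using (here)
open import Data.Nat using (ℕ; suc; pred)
open import Data.Nat.Properties using (suc-injective)
open import Data.Product using (Σ-syntax; ∃; ∃-syntax; _×_; _,_; proj₁; proj₂)
open import Data.Sum using (_⊎_; inj₁; inj₂; [_,_]′; map₂)
open import Data.Unit using (tt)
open import Function using (Injective; id; _∘_; _on_)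
open import Function.Bundles using (Equivalence; Injection)
import Function.Construct.Composition as Composition
import Function.Construct.Identity as Identity
open import Induction.WellFounded
  using (WfRec; WellFounded; Acc; acc; module FixPoint)
  renaming (module All to WfInduction)
import Relation.Binary.Construct.On as On
open import Relation.Binary.Core using (Rel)
open import Relation.Binary.Definitions using (Transitive)
open import Relation.Binary.PropositionalEquality
  using (_≡_; refl; sym; trans; cong; subst)
open import Relation.Nullary using (¬_; Dec; yes; no; contradiction)
open import Relation.Nullary.Decidable
  using (True; isYes; toWitness; fromWitness; decidable-stable)
open import Relation.Unary using (Pred; _∈_; _∉_; _⊆_; _≐_; _∪_; ｛_｝; U)

-- Subsets of ω and finite intersections

∩-to : ∀ A B {n} → n ∈ ⟦ A ∩ˢ B ⟧ → n ∈ ⟦ A ⟧ × n ∈ ⟦ B ⟧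
∩-to A B = Equivalence.to T-∧

∩-from : ∀ A B {n} → n ∈ ⟦ A ⟧ → n ∈ ⟦ B ⟧ → n ∈ ⟦ A ∩ˢ B ⟧
∩-from A B a b = Equivalence.from T-∧ (a , b)

T-not : ∀ b → T (not b) → ¬ T b
T-not true ()

T-lem : ∀ b → T b ⊎ T (not b)
T-lem true  = inj₁ tt
T-lem false = inj₂ tt

⋂-to : ∀ Xs {n} → n ∈ ⟦ ⋂ Xs ⟧ → All (λ X → n ∈ ⟦ X ⟧) Xs
⋂-to []       _ = []
⋂-to (X ∷ Xs) t with x , xs ← ∩-to X (⋂ Xs) t = x ∷ ⋂-to Xs xs

⋂-from : ∀ Xs {n} → All (λ X → n ∈ ⟦ X ⟧) Xs → n ∈ ⟦ ⋂ Xs ⟧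
⋂-from []       []       = tt
⋂-from (X ∷ Xs) (x ∷ xs) = ∩-from X (⋂ Xs) x (⋂-from Xs xs)

⋂-++ : ∀ Xs Ys {n} → n ∈ ⟦ ⋂ (Xs ++ Ys) ⟧ → n ∈ ⟦ ⋂ Xs ⟧ × n ∈ ⟦ ⋂ Ys ⟧
⋂-++ Xs Ys t = ⋂-from Xs (++⁻ˡ Xs ts) , ⋂-from Ys (++⁻ʳ Xs ts)
  where ts = ⋂-to (Xs ++ Ys) t

empty-finite : ∀ {A} → (∀ {n} → n ∉ ⟦ A ⟧) → Finite ⟦ A ⟧
empty-finite empty = [] , λ t → contradiction t empty

-- Positive finite intersections

-- 𝓙⁺-FIP without the requirement that the family be nonempty.
FIP : Family → Family → Set
FIP 𝓙 𝓐 = ∀ {Xs} → All (_∈ 𝓐) Xs → ⋂ Xs ∈ 𝓙 ⁺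

FIP-mono : ∀ 𝓙 {𝓐 𝓑} → 𝓐 ⊆ 𝓑 → FIP 𝓙 𝓑 → FIP 𝓙 𝓐
FIP-mono 𝓙 𝓐⊆𝓑 fip = fip ∘ All.map 𝓐⊆𝓑

-- The sets G i for i ∈ P.
image : ∀ {I : Set} → (I → Subset) → Pred I 0ℓ → Family
image G P X = ∃[ i ] i ∈ P × X ≡ G i

module Ideal {𝓙 : Family} (𝓙-ideal : IsIdeal 𝓙) where
  open IsIdeal 𝓙-ideal

  split-∩ : ∀ A B → A ∩ˢ B ∈ 𝓙 → A ∩ˢ ∁ˢ B ∈ 𝓙 → A ∈ 𝓙
  split-∩ A B p q = ⊆-closed cover (∪-closed p q)
    where
    cover : A ⊆ˢ (A ∩ˢ B) ∪ˢ (A ∩ˢ ∁ˢ B)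
    cover {n} a = Equivalence.from T-∨
      ([ inj₁ ∘ ∩-from A B a , inj₂ ∘ ∩-from A (∁ˢ B) a ]′ (T-lem (B n)))

  -- Finite intersections that involve X reduce to those with a single
  -- occurrence of X.
  FIP-adjoin : ∀ {𝓐 X} → (∀ {Ys} → All (_∈ 𝓐) Ys → ⋂ Ys ∩ˢ X ∉ 𝓙) →
               FIP 𝓙 (𝓐 ∪ ｛ X ｝)
  FIP-adjoin {𝓐} {X} pos {Xs} all ⋂Xs∈𝓙 =
    let Ys , ys , sub = separate all
    in pos ys (⊆-closed (λ t → let y , x = ∩-to (⋂ Ys) X t in sub y x) ⋂Xs∈𝓙)
    where
    separate : ∀ {Xs} → All (_∈ 𝓐 ∪ ｛ X ｝) Xs → ∃[ Ys ] All (_∈ 𝓐) Ys ×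
               (∀ {n} → n ∈ ⟦ ⋂ Ys ⟧ → n ∈ ⟦ X ⟧ → n ∈ ⟦ ⋂ Xs ⟧)
    separate [] = [] , [] , λ _ _ → tt
    separate {Z ∷ Zs} (inj₁ z ∷ zs) with Ys , ys , sub ← separate zs =
      Z ∷ Ys , z ∷ ys , λ t x →
        let t₁ , t₂ = ∩-to Z (⋂ Ys) t in ∩-from Z (⋂ Zs) t₁ (sub t₂ x)
    separate {Z ∷ Zs} (inj₂ refl ∷ zs) with Ys , ys , sub ← separate zs =
      Ys , ys , λ t x → ∩-from Z (⋂ Zs) x (sub t x)

  -- The ideal generated by 𝓙 and the complements of the members of 𝓑.
  generated : Family → Family
  generated 𝓑 X = ∃[ Ys ] All (_∈ 𝓑) Ys × ⋂ Ys ∩ˢ X ∈ 𝓙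

  ⊆-generated : ∀ {𝓑} → 𝓙 ⊆ generated 𝓑
  ⊆-generated X∈𝓙 = [] , [] , X∈𝓙

  ∁-generated : ∀ {𝓑 Y} → Y ∈ 𝓑 → ∁ˢ Y ∈ generated 𝓑
  ∁-generated {Y = Y} Y∈𝓑 = Y ∷ [] , Y∈𝓑 ∷ [] ,
    finite (empty-finite λ {n} t →
      let y , y′ = ∩-to (⋂ (Y ∷ [])) (∁ˢ Y) {n} t
      in T-not (Y n) y′ (proj₁ (∩-to Y ω {n} y)))

  generated-isIdeal : ∀ {𝓑} → FIP 𝓙 𝓑 → IsIdeal (generated 𝓑)
  generated-isIdeal fip = record
    { ∪-closed = λ { {A} {B} (Ys , ys , p) (Zs , zs , q) →
        Ys ++ Zs , ++⁺ ys zs , ⊆-closed (λ t →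
          let t₁ , t₂ = ∩-to (⋂ (Ys ++ Zs)) (A ∪ˢ B) t
              y  , z  = ⋂-++ Ys Zs t₁
          in Equivalence.from T-∨
               ([ inj₁ ∘ ∩-from (⋂ Ys) A y , inj₂ ∘ ∩-from (⋂ Zs) B z ]′
                 (Equivalence.to T-∨ t₂)))
          (∪-closed p q) }
    ; ⊆-closed = λ { {A} {B} A⊆B (Ys , ys , p) → Ys , ys , ⊆-closed (λ t →
        let y , a = ∩-to (⋂ Ys) A t in ∩-from (⋂ Ys) B y (A⊆B a)) p }
    ; finite   = λ fin → [] , [] , finite fin
    ; proper   = λ { (Ys , ys , p) →
        fip ys (⊆-closed (λ t → ∩-from (⋂ Ys) ω t tt) p) }
    }

disjoint-dual : ∀ {𝓤 A} → IsUltrafilter 𝓤 → A ∈ 𝓤 → A ∉ 𝓤 *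
disjoint-dual isU A∈𝓤 (B , B∈𝓤 , refl) = proper (⊆-closed
  (λ {n} t → let b′ , b = ∩-to (∁ˢ B) B {n} t in contradiction b (T-not (B n) b′))
  (∩-closed A∈𝓤 B∈𝓤))
  where open IsUltrafilter isU

-- Well-orders

-- A strict well-order.
record WellOrder (I : Set) : Set₁ where
  infix 4 _<_
  field
    _<_         : Rel I 0ℓ
    wellFounded : WellFounded _<_
    compare     : ∀ x y → x < y ⊎ x ≡ y ⊎ y < x
    <-trans     : Transitive _<_

  Below : I → Pred I 0ℓ
  Below i j = j < i

pullback : ∀ {I J : Set} (f : I → J) → Injective _≡_ _≡_ f →
           WellOrder J → WellOrder I
pullback f f-inj W = record
  { _<_         = _<_ on f
  ; wellFounded = On.wellFounded f wellFounded
  ; compare     = λ x y → map₂ [ inj₁ ∘ f-inj , inj₂ ]′ (compare (f x) (f y))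
  ; <-trans     = <-trans
  }
  where open WellOrder W

-- I embeds into the subset P.  As a map out of a set with propositional
-- equality respects equality, P may be a predicate with several proofs.
infix 4 _↪_
_↪_ : ∀ {A : Set} (I : Set) → Pred A 0ℓ → Set
I ↪ P = ∃[ g ] (∀ (i : I) → g i ∈ P) × Injective _≡_ _≡_ g

module Classical (em : ExcludedMiddle 0ℓ) (ext : Extensionality 0ℓ 0ℓ) where

  stable : ∀ {P : Set} → ¬ ¬ P → P
  stable = decidable-stable em

  -- Zermelo's theorem

  -- Parts of A are Boolean-valued so that parts with the same elements are
  -- equal and A has only a Set of parts.
  module Zermelo (A : Set) where

    Part : Set
    Part = A → Bool

    infix 4 _⊑_
    _⊑_ : Part → Part → Set
    X ⊑ Y = ∀ {a} → T (X a) → T (Y a)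

    ⊑-antisym : ∀ {X Y} → X ⊑ Y → Y ⊑ X → X ≡ Y
    ⊑-antisym {X} {Y} X⊑Y Y⊑X = ext λ a → T-ext (X a) (Y a) X⊑Y Y⊑X
      where
      T-ext : ∀ b c → (T b → T c) → (T c → T b) → b ≡ c
      T-ext true  true  _ _ = refl
      T-ext false false _ _ = refl
      T-ext true  false f _ = ⊥-elim (f tt)
      T-ext false true  _ g = ⊥-elim (g tt)

    -- The characteristic function of P.
    part : ∀ {B : Set} → Pred B 0ℓ → B → Bool
    part P b = isYes (em {P b})

    part-from : ∀ {B : Set} (P : Pred B 0ℓ) {b} → P b → T (part P b)
    part-from P = fromWitness

    part-to : ∀ {B : Set} (P : Pred B 0ℓ) {b} → T (part P b) → P b
    part-to P = toWitness

    -- Excluded middle returns an element outside X whenever there is one;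
    -- Next X a says that this element is a.
    Next : Part → Pred A 0ℓ
    Next X a = Σ[ a∉X ∈ ¬ T (X a) ] em {∃[ b ] ¬ T (X b)} ≡ yes (a , a∉X)

    next-exists : ∀ {X a} → ¬ T (X a) → ∃ (Next X)
    next-exists {X} {a} a∉X with em {∃[ b ] ¬ T (X b)}
    ... | yes (b , b∉X) = b , b∉X , refl
    ... | no none       = contradiction (a , a∉X) none

    next-unique : ∀ {X a b} → Next X a → Next X b → a ≡ b
    next-unique (_ , p) (_ , q) with refl ← trans (sym p) q = refl

    step : Part → Part
    step X = part λ a → T (X a) ⊎ Next X a

    step-⊒ : ∀ X → X ⊑ step X
    step-⊒ X = part-from (λ a → T (X a) ⊎ Next X a) ∘ inj₁

    step-to : ∀ X {a} → T (step X a) → T (X a) ⊎ Next X a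
    step-to X = part-to λ a → T (X a) ⊎ Next X a

    ⋃ : (Part → Bool) → Part
    ⋃ 𝒳 = part λ a → ∃[ X ] T (𝒳 X) × T (X a)

    ⋃-from : ∀ 𝒳 {X} → T (𝒳 X) → X ⊑ ⋃ 𝒳
    ⋃-from 𝒳 p q = part-from (λ a → ∃[ X ] T (𝒳 X) × T (X a)) (_ , p , q)

    ⋃-to : ∀ 𝒳 {a} → T (⋃ 𝒳 a) → ∃[ X ] T (𝒳 X) × T (X a)
    ⋃-to 𝒳 = part-to λ a → ∃[ X ] T (𝒳 X) × T (X a)

    -- The parts reached from the empty one, which is the union of no parts, by
    -- iterating step transfinitely.
    data Stage : Part → Set where
      next  : ∀ {X} → Stage X → Stage (step X)
      union : ∀ {𝒳} → (∀ {X} → T (𝒳 X) → Stage X) → Stage (⋃ 𝒳)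

    linear-step : ∀ {X Y} → X ⊑ Y ⊎ step Y ⊑ X → Y ⊑ X ⊎ step X ⊑ Y →
                  step X ⊑ Y ⊎ step Y ⊑ step X
    linear-step {X}     (inj₂ sY⊑X) _           = inj₂ (step-⊒ X ∘ sY⊑X)
    linear-step         (inj₁ X⊑Y)  (inj₂ sX⊑Y) = inj₁ sX⊑Y
    linear-step {X} {Y} (inj₁ X⊑Y)  (inj₁ Y⊑X)
      with refl ← ⊑-antisym {X} {Y} X⊑Y Y⊑X = inj₂ id

    linear-⋃ : ∀ {𝒳 Y} → (∀ {X} → T (𝒳 X) → X ⊑ Y ⊎ step Y ⊑ X) →
               ⋃ 𝒳 ⊑ Y ⊎ step Y ⊑ ⋃ 𝒳
    linear-⋃ {𝒳} {Y} h with em {∃[ X ] T (𝒳 X) × (step Y ⊑ X)}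
    ... | yes (X , p , sY⊑X) = inj₂ (⋃-from 𝒳 p ∘ sY⊑X)
    ... | no none = inj₁ λ t → let X , p , q = ⋃-to 𝒳 t in
      [ (λ X⊑Y → X⊑Y q)
      , (λ sY⊑X → contradiction (X , p , λ {a} → sY⊑X {a}) none) ]′ (h p)

    -- Double induction: the inner induction `flipped` treats the statement
    -- with its arguments exchanged, X being fixed.
    linear : ∀ {X Y} → Stage X → Stage Y → X ⊑ Y ⊎ step Y ⊑ X
    linear (union h) Y-stage = linear-⋃ λ p → linear (h p) Y-stage
    linear (next {X} X-stage) Y-stage =
      linear-step (linear X-stage Y-stage) (flipped Y-stage)
      where
      flipped : ∀ {Y} → Stage Y → Y ⊑ X ⊎ step X ⊑ Y
      flipped (next Y-stage) =
        linear-step (flipped Y-stage) (linear X-stage Y-stage)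
      flipped (union h) = linear-⋃ λ p → flipped (h p)

    -- The largest stage that omits a.  The element added to it is a, and the
    -- elements of it are the predecessors of a.
    before : A → Part
    before a = ⋃ (part λ X → Stage X × ¬ T (X a))

    before-stage : ∀ a → Stage (before a)
    before-stage a = union (proj₁ ∘ part-to λ X → Stage X × ¬ T (X a))

    before-∌ : ∀ a → ¬ T (before a a)
    before-∌ a t =
      let X , p , q = ⋃-to (part λ X → Stage X × ¬ T (X a)) t
      in proj₂ (part-to (λ X → Stage X × ¬ T (X a)) p) q

    before-⊒ : ∀ {a X} → Stage X → ¬ T (X a) → X ⊑ before a
    before-⊒ {a} X-stage a∉X = ⋃-from (part λ X → Stage X × ¬ T (X a))
      (part-from (λ X → Stage X × ¬ T (X a)) (X-stage , a∉X))

    step-before-∋ : ∀ a → T (step (before a) a)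
    step-before-∋ a = stable λ a∉step →
      let b , b-next = next-exists (before-∌ a)
          b∈step = part-from (λ b → T (before a b) ⊎ Next (before a) b) (inj₂ b-next)
      in proj₁ b-next (before-⊒ (next (before-stage a)) a∉step b∈step)

    before-next : ∀ a → Next (before a) a
    before-next a = [ (λ t → contradiction t (before-∌ a)) , id ]′
      (step-to (before a) (step-before-∋ a))

    before-injective : ∀ {a b} → before a ≡ before b → a ≡ b
    before-injective {a} {b} eq =
      next-unique (before-next a) (subst (λ X → Next X b) (sym eq) (before-next b))

    infix 4 _<_
    _<_ : Rel A 0ℓ
    a < b = T (before b a)

    -- Stages are initial segments.
    stage-closed : ∀ {a b X} → Stage X → T (X b) → a < b → T (X a)
    stage-closed {b = b} X-stage b∈X a<b with linear (before-stage b) X-stage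
    ... | inj₁ below = below a<b
    ... | inj₂ above = contradiction (above (step-⊒ _ b∈X)) (before-∌ b)

    stage-accessible : ∀ {X} → Stage X → ∀ {a} → T (X a) → Acc _<_ a
    stage-accessible (union {𝒳} h) t =
      let _ , p , q = ⋃-to 𝒳 t in stage-accessible (h p) q
    stage-accessible (next {X} X-stage) {a} t with step-to X t
    ... | inj₁ a∈X    = stage-accessible X-stage a∈X
    ... | inj₂ a-next = acc λ b<a → stage-accessible X-stage (before-⊑ b<a)
      where
      before-⊑ : before a ⊑ X
      before-⊑ with linear (before-stage a) X-stage
      ... | inj₁ below = below
      ... | inj₂ above = contradiction (above t) (before-∌ a)

    <-compare : ∀ a b → a < b ⊎ a ≡ b ⊎ b < a
    <-compare a b with linear (before-stage a) (before-stage b)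
                     | linear (before-stage b) (before-stage a)
    ... | inj₂ above | _           = inj₂ (inj₂ (above (step-before-∋ b)))
    ... | inj₁ _     | inj₂ above  = inj₁ (above (step-before-∋ a))
    ... | inj₁ below | inj₁ below′ =
      inj₂ (inj₁ (before-injective (⊑-antisym below below′)))

    opaque
      -- Only the existence of a well-order matters later, not its construction.
      wellOrder : WellOrder A
      wellOrder = record
        { _<_         = _<_
        ; wellFounded = λ a →
            stage-accessible (next (before-stage a)) (step-before-∋ a)
        ; compare     = <-compare
        ; <-trans     = λ {_} {_} {c} a<b b<c → stage-closed (before-stage c) b<c a<b
        }

  least : ∀ {I : Set} (W : WellOrder I) (P : Pred I 0ℓ) →
          ∃ P → ∃[ i ] i ∈ P × (∀ j → j ∈ WellOrder.Below W i → j ∉ P)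
  least W P (i , i∈P) = stable λ none →
    WfInduction.wfRec wellFounded 0ℓ (_∉ P)
      (λ j ih j∈P → none (j , j∈P , λ _ k<j → ih k<j)) i i∈P
    where open WellOrder W

  -- A well-order of I whose type is an initial ordinal.  If I embeds into a
  -- segment of a given well-order, pull the order back along an embedding into
  -- the least such segment.
  initial-order : ∀ (I : Set) →
    Σ[ W ∈ WellOrder I ] (∀ i → ¬ (I ↪ WellOrder.Below W i))
  initial-order I = from (em {∃[ a ] (I ↪ Below a)})
    where
    W : WellOrder I
    W = Zermelo.wellOrder I
    open WellOrder W

    from : Dec (∃[ a ] (I ↪ Below a)) →
           Σ[ W ∈ WellOrder I ] (∀ i → ¬ (I ↪ WellOrder.Below W i))
    from (no none) = W , λ i e → none (i , e)
    from (yes ex) with least W (λ a → I ↪ Below a) ex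
    ... | a , (f , f<a , f-inj) , minimal = pullback f f-inj W ,
      λ { i (g , g<i , g-inj) →
            minimal (f i) (f<a i) (f ∘ g , g<i , g-inj ∘ f-inj) }

  -- Transfinite choice of sets with positive finite intersections

  module _ {I : Set} (W : WellOrder I) where
    open WellOrder W

    UpTo : I → Pred I 0ℓ
    UpTo i j = j < i ⊎ j ≡ i

    -- FIP concerns finitely many members at a time, and those come from a
    -- single initial segment.
    FIP-chain : ∀ 𝓙 (G : I → Subset) (P : Pred I 0ℓ) → ω ∉ 𝓙 →
                (∀ {i} → i ∈ P → FIP 𝓙 (image G (UpTo i))) → FIP 𝓙 (image G P)
    FIP-chain 𝓙 G P ω∉𝓙 fip all =
      [ (λ { refl → ω∉𝓙 }) , (λ (i , i∈P , all′) → fip i∈P all′) ]′ (bound all)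
      where
      grow : ∀ {i j} → i < j → image G (UpTo i) ⊆ image G (UpTo j)
      grow i<j (k , inj₁ k<i  , eq) = k , inj₁ (<-trans k<i i<j) , eq
      grow i<j (k , inj₂ refl , eq) = k , inj₁ i<j , eq

      bound : ∀ {Xs} → All (_∈ image G P) Xs →
              Xs ≡ [] ⊎ (∃[ i ] i ∈ P × All (_∈ image G (UpTo i)) Xs)
      bound [] = inj₁ refl
      bound ((i , i∈P , eq) ∷ xs) with bound xs
      ... | inj₁ refl = inj₂ (i , i∈P , (i , inj₂ refl , eq) ∷ [])
      ... | inj₂ (j , j∈P , ys) with compare i j
      ...   | inj₁ i<j        = inj₂ (j , j∈P , (i , inj₁ i<j , eq) ∷ ys)
      ...   | inj₂ (inj₁ i≡j) = inj₂ (j , j∈P , (i , inj₂ i≡j , eq) ∷ ys)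
      ...   | inj₂ (inj₂ j<i) =
        inj₂ (i , i∈P , (i , inj₂ refl , eq) ∷ All.map (grow j<i) ys)

    opaque
      -- If an acceptable set (one in Q i) can be added at every stage i without
      -- destroying FIP, then acceptable sets can be chosen simultaneously.
      transfinite : ∀ 𝓙 → ω ∉ 𝓙 → (Q : I → Family) →
        (∀ i (G : I → Subset) → FIP 𝓙 (image G (Below i)) →
          ∃[ X ] X ∈ Q i × FIP 𝓙 (image G (Below i) ∪ ｛ X ｝)) →
        ∃[ G ] (∀ i → G i ∈ Q i) × FIP 𝓙 (image G U)
      transfinite 𝓙 ω∉𝓙 Q extend =
        G , (λ i → proj₁ (spec i)) ,
        FIP-chain 𝓙 G U ω∉𝓙 (λ {i} _ → upTo i (proj₂ (spec i)))
        where
        Good : I → Family → Family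
        Good i 𝓐 X = X ∈ Q i × FIP 𝓙 (𝓐 ∪ ｛ X ｝)

        -- A member of 𝓧; the value ω for an empty 𝓧 is never used.
        choose : Family → Subset
        choose 𝓧 with em {∃ 𝓧}
        ... | yes (X , _) = X
        ... | no _        = ω

        choose-∈ : ∀ 𝓧 → ∃ 𝓧 → choose 𝓧 ∈ 𝓧
        choose-∈ 𝓧 ex with em {∃ 𝓧}
        ... | yes (_ , X∈𝓧) = X∈𝓧
        ... | no none       = contradiction ex none

        -- The value at i, given the values G at the indices below i.
        F : ∀ i → WfRec _<_ (λ _ → Subset) i → Subset
        F i G = choose (Good i λ X → ∃[ j ] Σ[ j<i ∈ j < i ] X ≡ G j<i)

        F-ext : ∀ i {G H : WfRec _<_ (λ _ → Subset) i} →
                (∀ {j} (j<i : j < i) → G {j} j<i ≡ H j<i) → F i G ≡ F i H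
        F-ext i G≡H = cong (λ (G : WfRec _<_ (λ _ → Subset) i) → F i (λ {j} → G {j}))
          (implicit-extensionality ext λ {j} → ext (G≡H {j}))

        G : I → Subset
        G = WfInduction.wfRec wellFounded 0ℓ (λ _ → Subset) F

        G-unfold : ∀ i → G i ≡ choose (Good i (image G (Below i)))
        G-unfold i = FixPoint.unfold-wfRec wellFounded (λ _ → Subset) F F-ext

        upTo : ∀ i → FIP 𝓙 (image G (Below i) ∪ ｛ G i ｝) → FIP 𝓙 (image G (UpTo i))
        upTo i = FIP-mono 𝓙 λ
          { (j , inj₁ j<i  , eq) → inj₁ (j , j<i , eq)
          ; (j , inj₂ refl , eq) → inj₂ (sym eq) }

        Spec : Pred I 0ℓ
        Spec i = G i ∈ Good i (image G (Below i))

        spec : ∀ i → Spec i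
        spec = WfInduction.wfRec wellFounded 0ℓ Spec λ i ih →
          subst (_∈ Good i (image G (Below i))) (sym (G-unfold i))
            (choose-∈ (Good i (image G (Below i)))
              (extend i G (FIP-chain 𝓙 G (Below i) ω∉𝓙 λ {j} j<i →
                upTo j (proj₂ (ih j<i)))))

  -- Ultrafilters

  -- Every ideal is contained in the dual ideal of an ultrafilter: for each set
  -- in turn, add the set or its complement to the sets chosen before.
  ideal-avoiding-ultrafilter : ∀ {𝓙} → IsIdeal 𝓙 →
    ∃[ 𝓤 ] IsUltrafilter 𝓤 × (∀ {X} → X ∈ 𝓙 → ∁ˢ X ∈ 𝓤)
  ideal-avoiding-ultrafilter {𝓙} 𝓙-ideal = 𝓤 , 𝓤-ultrafilter , λ {X} X∈𝓙 →
    [ (λ X∈𝓤 → contradiction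
        (⊆-closed (λ t → proj₁ (∩-to X ω t)) X∈𝓙) (fip (X∈𝓤 ∷ []))) , id ]′
    (ultra X)
    where
    open IsIdeal 𝓙-ideal
    open Ideal 𝓙-ideal

    decide : ∀ A {𝓐} → FIP 𝓙 𝓐 →
             ∃[ X ] (A ≡ X ⊎ ∁ˢ A ≡ X) × FIP 𝓙 (𝓐 ∪ ｛ X ｝)
    decide A {𝓐} fip with em {FIP 𝓙 (𝓐 ∪ ｛ A ｝)}
    ... | yes fip-A = A , inj₁ refl , fip-A
    ... | no ¬fip-A = ∁ˢ A , inj₂ refl , FIP-adjoin λ {Ys} ys ∁-small →
      ¬fip-A (FIP-adjoin λ {Zs} zs A-small →
        fip (++⁺ ys zs) (split-∩ (⋂ (Ys ++ Zs)) A
          (⊆-closed (λ t → let t₁ , a = ∩-to (⋂ (Ys ++ Zs)) A t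
                           in ∩-from (⋂ Zs) A (proj₂ (⋂-++ Ys Zs t₁)) a) A-small)
          (⊆-closed (λ t → let t₁ , a = ∩-to (⋂ (Ys ++ Zs)) (∁ˢ A) t
                           in ∩-from (⋂ Ys) (∁ˢ A) (proj₁ (⋂-++ Ys Zs t₁)) a) ∁-small)))

    decisions : ∃[ G ] (∀ A → A ≡ G A ⊎ ∁ˢ A ≡ G A) × FIP 𝓙 (image G U)
    decisions = transfinite (Zermelo.wellOrder Subset) 𝓙 proper
      (λ A → ｛ A ｝ ∪ ｛ ∁ˢ A ｝) (λ A G → decide A)

    fip : FIP 𝓙 (image (proj₁ decisions) U)
    fip = proj₂ (proj₂ decisions)

    𝓤 : Family
    𝓤 = image (proj₁ decisions) U

    ultra : ∀ A → A ∈ 𝓤 ⊎ ∁ˢ A ∈ 𝓤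
    ultra A = [ (λ eq → inj₁ (A , tt , eq)) , (λ eq → inj₂ (A , tt , eq)) ]′
      (proj₁ (proj₂ decisions) A)

    -- A set belongs to 𝓤 if its complement has finite intersection with some
    -- finite intersection of members of 𝓤.  The closure properties of an
    -- ultrafilter are instances of this.
    deduce : ∀ {Xs A} → All (_∈ 𝓤) Xs → Finite ⟦ ∁ˢ A ∩ˢ ⋂ Xs ⟧ → A ∈ 𝓤
    deduce {A = A} xs fin =
      [ id , (λ ∁A∈𝓤 → contradiction (finite fin) (fip (∁A∈𝓤 ∷ xs))) ]′ (ultra A)

    deduce-⊆ : ∀ {Xs A} → All (_∈ 𝓤) Xs → ⋂ Xs ⊆ˢ A → A ∈ 𝓤
    deduce-⊆ {Xs} {A} xs ⋂⊆A = deduce xs (empty-finite λ {n} t →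
      let ∁a , x = ∩-to (∁ˢ A) (⋂ Xs) {n} t in T-not (A n) ∁a (⋂⊆A x))

    𝓤-ultrafilter : IsUltrafilter 𝓤
    𝓤-ultrafilter = record
      { ∩-closed = λ {A} {B} A∈𝓤 B∈𝓤 → deduce-⊆ (A∈𝓤 ∷ B∈𝓤 ∷ []) λ t →
          let a , t′ = ∩-to A (B ∩ˢ ω) t in ∩-from A B a (proj₁ (∩-to B ω t′))
      ; ⊆-closed = λ {A} A⊆B A∈𝓤 →
          deduce-⊆ (A∈𝓤 ∷ []) (λ t → A⊆B (proj₁ (∩-to A ω t)))
      ; proper   = λ ∅∈𝓤 → fip (∅∈𝓤 ∷ []) (finite ([] , λ ()))
      ; ultra    = ultra
      ; cofinite = λ { {A} (ns , sub) →
          deduce [] (ns , λ t → sub (proj₁ (∩-to (∁ˢ A) ω t))) }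
      }

  FIP-extends-to-ultrafilter : ∀ {𝓙 𝓑} → IsIdeal 𝓙 → FIP 𝓙 𝓑 →
    ∃[ 𝓤 ] IsUltrafilter 𝓤 × 𝓑 ⊆ 𝓤 × 𝓙 ⊆ 𝓤 *
  FIP-extends-to-ultrafilter 𝓙-ideal fip =
    let 𝓤 , isU , dual = ideal-avoiding-ultrafilter (generated-isIdeal fip)
    in 𝓤 , isU ,
       (λ {Y} Y∈𝓑 → subst (_∈ 𝓤) (∁-involutive Y) (dual (∁-generated Y∈𝓑))) ,
       (λ {X} X∈𝓙 → ∁ˢ X , dual (⊆-generated X∈𝓙) , sym (∁-involutive X))
    where
    open Ideal 𝓙-ideal

    ∁-involutive : ∀ X → ∁ˢ (∁ˢ X) ≡ X
    ∁-involutive X = ext (not-involutive ∘ X)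

  -- The construction along 𝓕

  module Construction
    {𝓘 𝓙 : Family} (𝓙-ideal : IsIdeal 𝓙)
    {𝓕 : Pred (ℕ → ℕ) 0ℓ} {fip : Cardinal}
    (fip-min : IsFip 𝓘 𝓙 𝓕 fip) (𝓕≤fip : ∣ 𝓕 ∣ ≤ᶜ fip)
    (singleton : IsSingleton 𝓕 → ¬ (𝓘 ≤[ 𝓕 ] 𝓙))
    where
    open IsIdeal 𝓙-ideal
    open Ideal 𝓙-ideal

    -- The members of 𝓕 with a unique proof of membership, so that
    -- propositional equality counts each member once.
    Index : Set
    Index = Σ[ f ∈ (ℕ → ℕ) ] True (em {f ∈ 𝓕})

    fun : Index → ℕ → ℕ
    fun = proj₁

    index : ∀ {f} → f ∈ 𝓕 → Index
    index f∈𝓕 = _ , fromWitness f∈𝓕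

    fun-∈ : ∀ i → fun i ∈ 𝓕
    fun-∈ (f , t) = toWitness t

    fun-injective : Injective _≡_ _≡_ fun
    fun-injective {f , s} {.f , t} refl = cong (f ,_) (T-irrelevant s t)

    -- The candidates for f⁻¹[B_f], where f is the function with index i.
    Preimage : Index → Family
    Preimage i X = ∃[ B ] B ∈ 𝓘 × X ≡ fun i ⁻¹[ B ]

    -- Otherwise 𝓐 is one of the families over which fip is the minimum, and
    -- ∣ 𝓕 ∣ ≤ fip ≤ ∣ 𝓐 ∣.
    extendable : ∀ {𝓐} → HasFIP 𝓙 𝓐 → ¬ (Index ↪ 𝓐) → ∀ i →
                 ∃[ X ] X ∈ Preimage i × FIP 𝓙 (𝓐 ∪ ｛ X ｝)
    extendable {𝓐} 𝓐-fip small i =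
      let B , B∈𝓘 , _ , new-fip = stable (small ∘ embed) (fun-∈ i)
      in fun i ⁻¹[ B ] , (B , B∈𝓘 , refl) , new-fip
      where
      embed : NotExtendable 𝓘 𝓙 𝓕 𝓐 → Index ↪ 𝓐
      embed notExt =
        (λ i → proj₁ (to (fun i , fun-∈ i))) ,
        (λ i → proj₂ (to (fun i , fun-∈ i))) ,
        fun-injective ∘ injective
        where
        fip≤𝓐 : fip ≤ᶜ ∣ 𝓐 ∣
        fip≤𝓐 = proj₂ fip-min ∣ 𝓐 ∣
          (inj₂ (𝓐 , 𝓐-fip , notExt , Identity.bijection ∣ 𝓐 ∣))
        open Injection (Composition.injection 𝓕≤fip fip≤𝓐)

    -- The stage at which nothing has been chosen.  Unless 𝓕 is a singleton, it
    -- does not embed into the family with the single member ω.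
    extend-∅ : ∀ i → ∃[ X ] X ∈ Preimage i × X ∉ 𝓙
    extend-∅ i = from (em {IsSingleton 𝓕})
      where
      ω-fip : HasFIP 𝓙 ｛ ω ｝
      ω-fip = (ω , refl) , λ {Xs} all → proper ∘ ⊆-closed λ _ →
        ⋂-from Xs (All.map (λ { refl → tt }) all)

      ω-small : ¬ IsSingleton 𝓕 → ¬ (Index ↪ ｛ ω ｝)
      ω-small ¬sing (g , g-ω , g-inj) = ¬sing (fun i ,
        (λ {f} f∈𝓕 → cong fun (g-inj {i} {index f∈𝓕}
          (trans (sym (g-ω i)) (g-ω (index f∈𝓕))))) ,
        λ { refl → fun-∈ i })

      from : Dec (IsSingleton 𝓕) → ∃[ X ] X ∈ Preimage i × X ∉ 𝓙
      from (yes sing) = stable λ none → singleton sing (fun i , fun-∈ i ,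
        λ {B} B∈𝓘 → stable λ B∉ → none (fun i ⁻¹[ B ] , (B , B∈𝓘 , refl) , B∉))
      from (no ¬sing) with X , X-pre , new-fip ← extendable ω-fip (ω-small ¬sing) i =
        X , X-pre , λ X∈𝓙 →
          new-fip (inj₂ refl ∷ []) (⊆-closed (λ t → proj₁ (∩-to X ω t)) X∈𝓙)

    chosen : ∃[ G ] (∀ i → G i ∈ Preimage i) × FIP 𝓙 (image G U)
    chosen = transfinite W 𝓙 proper Preimage extend
      where
      W : WellOrder Index
      W = proj₁ (initial-order Index)
      open WellOrder W

      extend : ∀ i (G : Index → Subset) → FIP 𝓙 (image G (Below i)) →
               ∃[ X ] X ∈ Preimage i × FIP 𝓙 (image G (Below i) ∪ ｛ X ｝)
      extend i G so-far with em {∃ (Below i)}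
      ... | yes (j , j<i) = extendable ((G j , j , j<i , refl) , so-far)
        -- An embedding into the family gives one of indices of its members.
        (λ (g , g∈ , g-inj) → proj₂ (initial-order Index) i
          ( (λ k → proj₁ (g∈ k))
          , (λ k → proj₁ (proj₂ (g∈ k)))
          , λ {k} {l} eq → g-inj (trans (proj₂ (proj₂ (g∈ k)))
              (trans (cong G eq) (sym (proj₂ (proj₂ (g∈ l))))))))
        i
      ... | no none with X , X-pre , X∉𝓙 ← extend-∅ i =
        X , X-pre , FIP-adjoin λ
          { [] X∈𝓙 → X∉𝓙 X∈𝓙
          ; ((j , j<i , _) ∷ _) _ → none (j , j<i) }

    ultrafilter : ∃[ 𝓤 ] IsUltrafilter 𝓤 × ¬ (𝓘 ≤[ 𝓕 ] 𝓤 *) × 𝓙 ⊆ 𝓤 *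
    ultrafilter =
      let G , G-pre , G-fip = chosen
          𝓤 , isU , G⊆𝓤 , 𝓙⊆𝓤* = FIP-extends-to-ultrafilter 𝓙-ideal G-fip
      in 𝓤 , isU ,
         (λ (f , f∈𝓕 , below) →
           let B , B∈𝓘 , eq = G-pre (index f∈𝓕)
           in disjoint-dual isU (G⊆𝓤 (index f∈𝓕 , tt , sym eq)) (below B∈𝓘)) ,
         𝓙⊆𝓤*

-- The families of all, finite-to-one, and one-to-one functions

id-suc-not-singleton : ∀ {𝓕} → id ∈ 𝓕 → suc ∈ 𝓕 → ¬ IsSingleton 𝓕
id-suc-not-singleton id∈ suc∈ (_ , only , _)
  with () ← cong (λ f → f 0) (trans (sym (only id∈)) (only suc∈))

dual-not-point : ∀ {𝓙 𝓤} → 𝓙 ⊆ 𝓤 * → ¬ Point-for 𝓙 𝓤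
dual-not-point 𝓙⊆𝓤* (_ , 𝓙≰𝓤*) = 𝓙≰𝓤* (id , id , 𝓙⊆𝓤*)

≤-resp-⊆ : ∀ 𝓘 𝓚 {𝓕 𝓖} → 𝓕 ⊆ 𝓖 → 𝓘 ≤[ 𝓕 ] 𝓚 → 𝓘 ≤[ 𝓖 ] 𝓚
≤-resp-⊆ 𝓘 𝓚 𝓕⊆𝓖 (f , f∈𝓕 , below) = f , 𝓕⊆𝓖 f∈𝓕 , below

id-finiteToOne : id ∈ FiniteToOne
id-finiteToOne n = n ∷ [] , here

suc-finiteToOne : suc ∈ FiniteToOne
suc-finiteToOne n = pred n ∷ [] , λ { refl → here refl }

theorem3p2 : ExcludedMiddle 0ℓ → Extensionality 0ℓ 0ℓ →
    (𝓘 𝓙 : Family) → IsIdeal 𝓘 → IsIdeal 𝓙 →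
    (𝓕 : Pred (ℕ → ℕ) 0ℓ) →
    (fip : Cardinal) → IsFip 𝓘 𝓙 𝓕 fip →
    ∣ 𝓕 ∣ ≤ᶜ fip →
    ((IsSingleton 𝓕 → ¬ (𝓘 ≤[ 𝓕 ] 𝓙)) →
    ∃[ 𝓤 ] IsUltrafilter 𝓤 × ¬ (𝓘 ≤[ 𝓕 ] 𝓤 *) × 𝓙 ⊆ 𝓤 *)
    × (𝓕 ≐ AllFunctions →
    ∃[ 𝓤 ] Ultrafilter-for 𝓘 𝓤 × ¬ Point-for 𝓙 𝓤)
    × (𝓕 ≐ FiniteToOne →
    ∃[ 𝓤 ] WeakUltrafilter-for 𝓘 𝓤 × ¬ Point-for 𝓙 𝓤)
    × (𝓕 ≐ OneToOne →
    ∃[ 𝓤 ] Point-for 𝓘 𝓤 × ¬ Point-for 𝓙 𝓤)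
theorem3p2 em ext 𝓘 𝓙 _ 𝓙-ideal 𝓕 fip fip-min 𝓕≤fip =
  ultrafilter ,
  special tt tt ,
  special id-finiteToOne suc-finiteToOne ,
  special id suc-injective
  where
  open Classical em ext
  open Construction 𝓙-ideal fip-min 𝓕≤fip

  special : ∀ {𝓖} → id ∈ 𝓖 → suc ∈ 𝓖 → 𝓕 ≐ 𝓖 →
    ∃[ 𝓤 ] (IsUltrafilter 𝓤 × ¬ (𝓘 ≤[ 𝓖 ] 𝓤 *)) × ¬ Point-for 𝓙 𝓤
  special id∈𝓖 suc∈𝓖 (_ , 𝓖⊆𝓕)
    with 𝓤 , isU , 𝓘≰𝓤* , 𝓙⊆𝓤* ←
      ultrafilter (λ sing → contradiction sing
        (id-suc-not-singleton (𝓖⊆𝓕 id∈𝓖) (𝓖⊆𝓕 suc∈𝓖))) =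
    𝓤 , (isU , 𝓘≰𝓤* ∘ ≤-resp-⊆ 𝓘 (𝓤 *) 𝓖⊆𝓕) , dual-not-point 𝓙⊆𝓤*
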